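{- Let Seq$S$ be any of the calculi SeqCK, SeqID, SeqMP, SeqID+MP. For all finite multisets $\Gamma,\Delta$ of labelled and transition formulas and every labelled or transition formula $F$: if $\Gamma\vdash\Delta,F$ and $F,\Gamma\vdash\Delta$ are derivable in Seq$S$, then so is $\Gamma\vdash\Delta$.
   Context: Formulas are built from propositional variables and $\bot$ by the binary connectives $\to$ and $\Rightarrow$. Fix a denumerable set $\mathcal{A}$ of labels. A labelled formula is $x:A$ and a transition formula is $x\xrightarrow{A}y$, with $x,y\in\mathcal{A}$ and $A$ a formula. A sequent $\Gamma\vdash\Delta$ is a pair of finite multisets of labelled and transition formulas. Calculus Seq$S$, $S\in\{$CK, ID, MP, ID+MP$\}$ ($F$ is any labelled or transition formula): (AX) axiom $\Gamma,F\vdash\Delta,F$. (A$\bot$) axiom $\Gamma,x:\bot\vdash\Delta$. (Weak L) from $\Gamma\vdash\Delta$ infer $\Gamma,F\vdash\Delta$. (Weak R) from $\Gamma\vdash\Delta$ infer $\Gamma\vdash\Delta,F$. (Contr L) from $\Gamma,F,F\vdash\Delta$ infer $\Gamma,F\vdash\Delta$. (Contr R) from $\Gamma\vdash\Delta,F,F$ infer $\Gamma\vdash\Delta,F$. ($\to$R) from $\Gamma,x:A\vdash x:B,\Delta$ infer $\Gamma\vdash x:A\to B,\Delta$. ($\to$L) from $\Gamma\vdash x:A,\Delta$ and $\Gamma,x:B\vdash\Delta$ infer $\Gamma,x:A\to B\vdash\Delta$. (EQ) from $u:A\vdash u:B$ and $u:B\vdash u:A$ infer $\Gamma,x\xrightarrow{A}y\vdash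 x\xrightarrow{B}y,\Delta$. ($\Rightarrow$L) from $\Gamma\vdash x\xrightarrow{A}y,\Delta$ and $\Gamma,y:B\vdash\Delta$ infer $\Gamma,x:A\Rightarrow B\vdash\Delta$. ($\Rightarrow$R) from $\Gamma,x\xrightarrow{A}y\vdash y:B,\Delta$ infer $\Gamma\vdash x:A\Rightarrow B,\Delta$, where the label $y$ does not occur in $\Gamma,\Delta$ and $y\neq x$. (ID) (only in SeqID and SeqID+MP) from $\Gamma,y:A\vdash\Delta$ infer $\Gamma,x\xrightarrow{A}y\vdash\Delta$. (MP) (only in SeqMP and SeqID+MP) from $\Gamma\vdash x:A,\Delta$ infer $\Gamma\vdash x\xrightarrow{A}x,\Delta$. -}

module Defs where

open import Data.Nat using (ℕ)
open import Data.List using (List; []; _∷_)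
open import Data.List.Membership.Propositional using (_∉_)
open import Data.List.Relation.Unary.All using (All)
open import Data.List.Relation.Binary.Permutation.Propositional using (_↭_)
open import Function.Bundles using (_↔_)
open import Relation.Binary.PropositionalEquality using (_≢_)

infixr 30 _⟶_ _⇒_
infix  25 _∶_ _─⟨_⟩→_
infix  4 _⊢[_]_

Denumerable : Set → Set
Denumerable 𝒜 = 𝒜 ↔ ℕ

data Formula (Atom : Set) : Set where
  var : Atom → Formula Atom
  ⊥′  : Formula Atom
  _⟶_ : Formula Atom → Formula Atom → Formula Atom
  _⇒_ : Formula Atom → Formula Atom → Formula Atom

data SeqFormula (Atom 𝒜 : Set) : Set where
  _∶_     : 𝒜 → Formula Atom → SeqFormula Atom 𝒜
  _─⟨_⟩→_ : 𝒜 → Formula Atom → 𝒜 → SeqFormula Atom 𝒜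

labels : ∀ {Atom 𝒜} → SeqFormula Atom 𝒜 → List 𝒜
labels (x ∶ A)        = x ∷ []
labels (x ─⟨ A ⟩→ y)  = x ∷ y ∷ []

_FreshFor_ : ∀ {Atom 𝒜} → 𝒜 → List (SeqFormula Atom 𝒜) → Set
y FreshFor Γ = All (λ F → y ∉ labels F) Γ

data Calculus : Set where
  CK ID MP ID+MP : Calculus

data HasID : Calculus → Set where
  inID    : HasID ID
  inID+MP : HasID ID+MP

data HasMP : Calculus → Set where
  inMP    : HasMP MP
  inID+MP : HasMP ID+MP

-- Γ ⊢[ S ] Δ is the type of derivations of the sequent Γ ⊢ Δ in Seq S.
-- A finite multiset is represented by a list of its elements; `perm` makes
-- derivability independent of the order chosen, so a rule stated with its
-- principal formula at the head applies to any occurrence of that formula.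
data _⊢[_]_ {Atom 𝒜 : Set} :
       List (SeqFormula Atom 𝒜) → Calculus → List (SeqFormula Atom 𝒜) → Set where

  perm : ∀ {S Γ Γ′ Δ Δ′} → Γ ↭ Γ′ → Δ ↭ Δ′ →
         Γ ⊢[ S ] Δ →
         Γ′ ⊢[ S ] Δ′

  AX : ∀ {S Γ Δ F} →
       F ∷ Γ ⊢[ S ] F ∷ Δ

  A⊥ : ∀ {S Γ Δ x} →
       x ∶ ⊥′ ∷ Γ ⊢[ S ] Δ

  WeakL : ∀ {S Γ Δ F} →
          Γ ⊢[ S ] Δ →
          F ∷ Γ ⊢[ S ] Δ

  WeakR : ∀ {S Γ Δ F} →
          Γ ⊢[ S ] Δ →
          Γ ⊢[ S ] F ∷ Δ

  ContrL : ∀ {S Γ Δ F} →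
           F ∷ F ∷ Γ ⊢[ S ] Δ →
           F ∷ Γ ⊢[ S ] Δ

  ContrR : ∀ {S Γ Δ F} →
           Γ ⊢[ S ] F ∷ F ∷ Δ →
           Γ ⊢[ S ] F ∷ Δ

  ⟶R : ∀ {S Γ Δ x A B} →
       x ∶ A ∷ Γ ⊢[ S ] x ∶ B ∷ Δ →
       Γ ⊢[ S ] x ∶ A ⟶ B ∷ Δ

  ⟶L : ∀ {S Γ Δ x A B} →
       Γ ⊢[ S ] x ∶ A ∷ Δ →
       x ∶ B ∷ Γ ⊢[ S ] Δ →
       x ∶ A ⟶ B ∷ Γ ⊢[ S ] Δ

  EQ : ∀ {S Γ Δ x y A B} {u : 𝒜} →
       u ∶ A ∷ [] ⊢[ S ] u ∶ B ∷ [] →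
       u ∶ B ∷ [] ⊢[ S ] u ∶ A ∷ [] →
       x ─⟨ A ⟩→ y ∷ Γ ⊢[ S ] x ─⟨ B ⟩→ y ∷ Δ

  ⇒L : ∀ {S Γ Δ x y A B} →
       Γ ⊢[ S ] x ─⟨ A ⟩→ y ∷ Δ →
       y ∶ B ∷ Γ ⊢[ S ] Δ →
       x ∶ A ⇒ B ∷ Γ ⊢[ S ] Δ

  ⇒R : ∀ {S Γ Δ x y A B} →
       y FreshFor Γ → y FreshFor Δ → y ≢ x →
       x ─⟨ A ⟩→ y ∷ Γ ⊢[ S ] y ∶ B ∷ Δ →
       Γ ⊢[ S ] x ∶ A ⇒ B ∷ Δ

  idL : ∀ {S Γ Δ x y A} → HasID S →
        y ∶ A ∷ Γ ⊢[ S ] Δ →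
        x ─⟨ A ⟩→ y ∷ Γ ⊢[ S ] Δ

  mpR : ∀ {S Γ Δ x A} → HasMP S →
        Γ ⊢[ S ] x ∶ A ∷ Δ →
        Γ ⊢[ S ] x ─⟨ A ⟩→ x ∷ Δ

{-# OPTIONS --safe #-}

-- Weakening and contraction make derivability depend only on the sets of
-- formulas on the two sides, so Seq S is equivalent to a calculus Γ ⊩ Δ in
-- which principal formulas are found by membership and are kept in the
-- premises.  There ⇒R has one premise for every label in place of a fresh one,
-- and EQ likewise; weakening then needs no renaming of labels.  The cut rule is
-- admissible in ⊩ by induction on the cut formula, the transition formula
-- x ─⟨ A ⟩→ y counting as larger than every z ∶ A: an induction on the left
-- derivation brings the cut formula to the last rule, and then an induction on
-- the right derivation removes it there.
module Submission where

open import Defs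
open import Data.Empty using (⊥-elim)
open import Data.List using (List; []; _∷_; _++_; map; concatMap)
open import Data.List.Extrema.Nat using (max; xs≤max)
open import Data.List.Membership.Propositional using (_∈_; _∉_)
open import Data.List.Membership.Propositional.Properties using (∈-∃++; ∈-map⁺)
open import Data.List.Properties using (map-cong-local; map-id-local)
open import Data.List.Relation.Binary.Permutation.Propositional using (_↭_; refl; prep; ↭-sym)
open import Data.List.Relation.Binary.Permutation.Propositional.Properties using (shift)
open import Data.List.Relation.Binary.Subset.Propositional using (_⊆_)
open import Data.List.Relation.Binary.Subset.Propositional.Properties
  using (⊆-refl; ⊆-reflexive-↭; ∷⁺ʳ; ∈-∷⁺ʳ; map⁺)
open import Data.List.Relation.Unary.All as All using (All; []; _∷_)
open import Data.List.Relation.Unary.All.Properties using (++⁻ˡ; ++⁻ʳ; concat⁻; map⁻; ¬Any⇒All¬)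
open import Data.List.Relation.Unary.Any using (here; there)
open import Data.Nat using (ℕ; suc; _≤_)
open import Data.Nat.Properties using (eq?; 1+n≰n)
open import Data.Product using (_×_; _,_; ∃-syntax)
open import Data.Unit using (⊤; tt)
open import Function using (id; _∘_)
open import Function.Bundles using (module Inverse)
open import Function.Properties.Inverse using (↔⇒↣)
open import Relation.Binary.Definitions using (DecidableEquality)
open import Relation.Binary.PropositionalEquality
  using (_≡_; _≢_; refl; sym; cong; cong₂; subst; subst₂)
open import Relation.Nullary using (yes; no)

-- The calculus with shared contexts

infix 4 _⊩[_]_

data _⊩[_]_ {Atom 𝒜 : Set} (Γ : List (SeqFormula Atom 𝒜)) (S : Calculus)
            (Δ : List (SeqFormula Atom 𝒜)) : Set where

  ax  : ∀ {F} → F ∈ Γ → F ∈ Δ → Γ ⊩[ S ] Δ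

  bot : ∀ {x} → x ∶ ⊥′ ∈ Γ → Γ ⊩[ S ] Δ

  impR : ∀ {x A B} → x ∶ A ⟶ B ∈ Δ →
         x ∶ A ∷ Γ ⊩[ S ] x ∶ B ∷ Δ → Γ ⊩[ S ] Δ

  impL : ∀ {x A B} → x ∶ A ⟶ B ∈ Γ →
         Γ ⊩[ S ] x ∶ A ∷ Δ → x ∶ B ∷ Γ ⊩[ S ] Δ → Γ ⊩[ S ] Δ

  eq : ∀ {x y A B} → x ─⟨ A ⟩→ y ∈ Γ → x ─⟨ B ⟩→ y ∈ Δ →
       ((u : 𝒜) → u ∶ A ∷ [] ⊩[ S ] u ∶ B ∷ []) →
       ((u : 𝒜) → u ∶ B ∷ [] ⊩[ S ] u ∶ A ∷ []) → Γ ⊩[ S ] Δ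

  condL : ∀ {x y A B} → x ∶ A ⇒ B ∈ Γ →
          Γ ⊩[ S ] x ─⟨ A ⟩→ y ∷ Δ → y ∶ B ∷ Γ ⊩[ S ] Δ → Γ ⊩[ S ] Δ

  condR : ∀ {x A B} → x ∶ A ⇒ B ∈ Δ →
          (∀ y → x ─⟨ A ⟩→ y ∷ Γ ⊩[ S ] y ∶ B ∷ Δ) → Γ ⊩[ S ] Δ

  ident : ∀ {x y A} → HasID S → x ─⟨ A ⟩→ y ∈ Γ →
          y ∶ A ∷ Γ ⊩[ S ] Δ → Γ ⊩[ S ] Δ

  mp : ∀ {x A} → HasMP S → x ─⟨ A ⟩→ x ∈ Δ →
       Γ ⊩[ S ] x ∶ A ∷ Δ → Γ ⊩[ S ] Δ

-- List inclusions and occurrences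

module _ {A : Set} where

  -- Serves rules that add `z` to a premise: the cut formula `x` stays at the head of the bound,
  -- where the induction hypotheses expect it.
  ⊆-under : {x z : A} {xs ys : List A} → xs ⊆ x ∷ ys → z ∷ xs ⊆ x ∷ z ∷ ys
  ⊆-under xs⊆ (here refl) = there (here refl)
  ⊆-under xs⊆ (there p) with xs⊆ p
  ... | here refl = here refl
  ... | there q = there (there q)

  ⊆-contract : {x : A} {xs : List A} → x ∷ x ∷ xs ⊆ x ∷ xs
  ⊆-contract = ∈-∷⁺ʳ (here refl) ⊆-refl

  ∈⇒↭-head : {x : A} {xs : List A} → x ∈ xs → ∃[ ys ] xs ↭ x ∷ ys
  ∈⇒↭-head x∈xs with ys , zs , refl ← ∈-∃++ x∈xs = ys ++ zs , shift _ ys zs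

-- Weakening and cut admissibility for `⊩`

module _ {Atom 𝒜 : Set} {S : Calculus} where

  private
    Formulas : Set
    Formulas = List (SeqFormula Atom 𝒜)

  weaken : {Γ Γ′ Δ Δ′ : Formulas} → Γ ⊆ Γ′ → Δ ⊆ Δ′ → Γ ⊩[ S ] Δ → Γ′ ⊩[ S ] Δ′
  weaken s t (ax m n)      = ax (s m) (t n)
  weaken s t (bot m)       = bot (s m)
  weaken s t (impR m D)    = impR (t m) (weaken (∷⁺ʳ _ s) (∷⁺ʳ _ t) D)
  weaken s t (impL m D E)  = impL (s m) (weaken s (∷⁺ʳ _ t) D) (weaken (∷⁺ʳ _ s) t E)
  weaken s t (eq m n D E)  = eq (s m) (t n) D E
  weaken s t (condL m D E) = condL (s m) (weaken s (∷⁺ʳ _ t) D) (weaken (∷⁺ʳ _ s) t E)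
  weaken s t (condR m D)   = condR (t m) λ y → weaken (∷⁺ʳ _ s) (∷⁺ʳ _ t) (D y)
  weaken s t (ident h m D) = ident h (s m) (weaken (∷⁺ʳ _ s) t D)
  weaken s t (mp h m D)    = mp h (t m) (weaken s (∷⁺ʳ _ t) D)

  weakenL : {Γ Δ : Formulas} {F : SeqFormula Atom 𝒜} → Γ ⊩[ S ] Δ → F ∷ Γ ⊩[ S ] Δ
  weakenL = weaken there ⊆-refl

  weakenR : {Γ Δ : Formulas} {F : SeqFormula Atom 𝒜} → Γ ⊩[ S ] Δ → Γ ⊩[ S ] F ∷ Δ
  weakenR = weaken ⊆-refl there

  weaken-singletons : {Γ Δ : Formulas} {F G : SeqFormula Atom 𝒜} →
                      F ∷ [] ⊩[ S ] G ∷ [] → F ∷ Γ ⊩[ S ] G ∷ Δ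
  weaken-singletons = weaken (∷⁺ʳ _ λ ()) (∷⁺ʳ _ λ ())

  -- The premises of a right rule with principal formula F, with F itself
  -- absent from them.
  data RightIntro (Γ Δ : Formulas) : SeqFormula Atom 𝒜 → Set where
    impR : ∀ {x A B} → x ∶ A ∷ Γ ⊩[ S ] x ∶ B ∷ Δ → RightIntro Γ Δ (x ∶ A ⟶ B)
    eq   : ∀ {x y A B} → x ─⟨ A ⟩→ y ∈ Γ →
           ((u : 𝒜) → u ∶ A ∷ [] ⊩[ S ] u ∶ B ∷ []) →
           ((u : 𝒜) → u ∶ B ∷ [] ⊩[ S ] u ∶ A ∷ []) →
           RightIntro Γ Δ (x ─⟨ B ⟩→ y)
    condR : ∀ {x A B} → (∀ y → x ─⟨ A ⟩→ y ∷ Γ ⊩[ S ] y ∶ B ∷ Δ) →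
            RightIntro Γ Δ (x ∶ A ⇒ B)
    mp   : ∀ {x A} → HasMP S → Γ ⊩[ S ] x ∶ A ∷ Δ → RightIntro Γ Δ (x ─⟨ A ⟩→ x)

  weaken-intro : {Γ Γ′ Δ Δ′ : Formulas} {F : SeqFormula Atom 𝒜} →
                 Γ ⊆ Γ′ → Δ ⊆ Δ′ → RightIntro Γ Δ F → RightIntro Γ′ Δ′ F
  weaken-intro s t (impR D)   = impR (weaken (∷⁺ʳ _ s) (∷⁺ʳ _ t) D)
  weaken-intro s t (eq m D E) = eq (s m) D E
  weaken-intro s t (condR D)  = condR λ y → weaken (∷⁺ʳ _ s) (∷⁺ʳ _ t) (D y)
  weaken-intro s t (mp h D)   = mp h (weaken s (∷⁺ʳ _ t) D)

  introduce : {Γ Δ : Formulas} {F : SeqFormula Atom 𝒜} →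
              RightIntro Γ Δ F → F ∈ Δ → Γ ⊩[ S ] Δ
  introduce (impR D)   n = impR n D
  introduce (eq m D E) n = eq m n D E
  introduce (condR D)  n = condR n D
  introduce (mp h D)   n = mp h n D

  Cut : SeqFormula Atom 𝒜 → Set
  Cut F = {Γ Δ : Formulas} → Γ ⊩[ S ] F ∷ Δ → F ∷ Γ ⊩[ S ] Δ → Γ ⊩[ S ] Δ

  -- The smaller cuts that the principal reductions call. A transition formula needs them at every
  -- label, because reducing `eq` against `eq` cuts at each `u`.
  CutBelow : SeqFormula Atom 𝒜 → Set
  CutBelow (x ∶ var p)      = ⊤
  CutBelow (x ∶ ⊥′)         = ⊤
  CutBelow (x ∶ A ⟶ B)      = (∀ y → Cut (y ∶ A)) × (∀ y → Cut (y ∶ B))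
  CutBelow (x ∶ A ⇒ B)      = (∀ y → Cut (x ─⟨ A ⟩→ y)) × (∀ y → Cut (y ∶ B))
  CutBelow (x ─⟨ A ⟩→ y)    = ∀ z → Cut (z ∶ A)

  -- Recursion is on the right derivation, so only `P` is ever weakened. The bound `Γ₂ ⊆ F ∷ Γ`
  -- admits any number of copies of `F`, including the one a left rule keeps in its premises; where
  -- `F` is principal, the recursive calls first clear it from those premises, and `c` then cuts
  -- smaller formulas.
  cut-principal : ∀ {F} → CutBelow F → {Γ Γ₂ Δ Δ₂ : Formulas} →
                  RightIntro Γ Δ F → Γ₂ ⊆ F ∷ Γ → Δ₂ ⊆ Δ → Γ₂ ⊩[ S ] Δ₂ → Γ ⊩[ S ] Δ
  cut-principal c P s t (ax m n) with s m
  -- The axiom is on `F`, so `F` is also on the right and can be introduced there by its own rule.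
  ... | here refl = introduce P (t n)
  ... | there m′  = ax m′ (t n)
  cut-principal c P s t (bot m) with s m
  cut-principal c () s t (bot m) | here refl
  ... | there m′  = bot m′
  cut-principal c P s t (impR m D) =
    impR (t m) (cut-principal c (weaken-intro there there P) (⊆-under s) (∷⁺ʳ _ t) D)
  cut-principal c P s t (impL m D E)
    with cut-principal c (weaken-intro ⊆-refl there P) s (∷⁺ʳ _ t) D
       | cut-principal c (weaken-intro there ⊆-refl P) (⊆-under s) t E | s m
  cut-principal (cutA , cutB) (impR P) s t (impL m D E) | D′ | E′ | here refl =
    cutB _ (cutA _ (weaken ⊆-refl (∷⁺ʳ _ there) D′) P) E′
  ... | D′ | E′ | there m′ = impL m′ D′ E′
  cut-principal c P s t (eq m n D E) with s m
  -- Provable equivalence is transitive: cut the middle antecedent at every `u`, in both directions.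
  cut-principal c (eq m′ P Q) s t (eq m n D E) | here refl =
    eq m′ (t n) (λ u → c u (weaken ⊆-refl (∷⁺ʳ _ λ ()) (P u)) (weaken-singletons (D u)))
                (λ u → c u (weaken-singletons (E u)) (weaken-singletons (Q u)))
  -- At the label of the loop, the equivalence replaces the antecedent proved by `P`, so `mp` yields
  -- the other transition formula.
  cut-principal c (mp h P) s t (eq m n D E) | here refl =
    mp h (t n) (c _ (weaken ⊆-refl (∷⁺ʳ _ there) P) (weaken-singletons (D _)))
  ... | there m′ = eq m′ (t n) D E
  cut-principal c P s t (condL m D E)
    with cut-principal c (weaken-intro ⊆-refl there P) s (∷⁺ʳ _ t) D
       | cut-principal c (weaken-intro there ⊆-refl P) (⊆-under s) t E | s m
  -- `P` is instantiated at the target label that `condL` chose.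
  cut-principal (cutA , cutB) (condR P) s t (condL m D E) | D′ | E′ | here refl =
    cutB _ (cutA _ (weaken ⊆-refl (∷⁺ʳ _ there) D′) (P _)) E′
  ... | D′ | E′ | there m′ = condL m′ D′ E′
  cut-principal c P s t (condR m D) =
    condR (t m) λ y →
      cut-principal c (weaken-intro there there P) (⊆-under s) (∷⁺ʳ _ t) (D y)
  cut-principal c P s t (ident h m D)
    with cut-principal c (weaken-intro there ⊆-refl P) (⊆-under s) t D | s m
  -- Apply `ident` to the transition formula that `eq` found in `Γ`, and pass to the cut antecedent
  -- by the equivalence at the target label.
  cut-principal c (eq m′ P Q) s t (ident h m D) | D′ | here refl =
    ident h m′ (c _ (weaken-singletons (P _)) (weaken (∷⁺ʳ _ there) ⊆-refl D′))
  cut-principal c (mp _ P) s t (ident h m D) | D′ | here refl = c _ P D′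
  ... | D′ | there m′ = ident h m′ D′
  cut-principal c P s t (mp h m D) =
    mp h (t m) (cut-principal c (weaken-intro ⊆-refl there P) s (∷⁺ʳ _ t) D)

  -- Recursion is on the left derivation, so the right one may be weakened to follow the growing
  -- contexts. When a right rule introduces `F`, its premises, cleared of `F`, form the `RightIntro`
  -- that `cut-principal` takes.
  cut-step : ∀ {F} → CutBelow F → {Γ Γ₁ Δ Δ₁ : Formulas} →
             Γ₁ ⊆ Γ → Δ₁ ⊆ F ∷ Δ → Γ₁ ⊩[ S ] Δ₁ → F ∷ Γ ⊩[ S ] Δ → Γ ⊩[ S ] Δ
  cut-step c s t (ax m n) E with t n
  -- Here `F` already lies in `Γ`, so its extra copy in `E` is contracted.
  ... | here refl = weaken (∈-∷⁺ʳ (s m) ⊆-refl) ⊆-refl E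
  ... | there n′  = ax (s m) n′
  cut-step c s t (bot m) E = bot (s m)
  cut-step c s t (impR n D) E
    with cut-step c (∷⁺ʳ _ s) (⊆-under t) D (weaken (∷⁺ʳ _ there) there E) | t n
  ... | D′ | here refl = cut-principal c (impR D′) ⊆-refl ⊆-refl E
  ... | D′ | there n′  = impR n′ D′
  cut-step c s t (impL m D D₁) E =
    impL (s m) (cut-step c s (⊆-under t) D (weakenR E))
               (cut-step c (∷⁺ʳ _ s) t D₁ (weaken (∷⁺ʳ _ there) ⊆-refl E))
  cut-step c s t (eq m n D D₁) E with t n
  -- The premises of `eq` discard the context, so there is no `F` to clear from them.
  ... | here refl = cut-principal c (eq (s m) D D₁) ⊆-refl ⊆-refl E
  ... | there n′  = eq (s m) n′ D D₁
  cut-step c s t (condL m D D₁) E =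
    condL (s m) (cut-step c s (⊆-under t) D (weakenR E))
                (cut-step c (∷⁺ʳ _ s) t D₁ (weaken (∷⁺ʳ _ there) ⊆-refl E))
  cut-step c s t (condR n D) E
    with (λ y → cut-step c (∷⁺ʳ _ s) (⊆-under t) (D y) (weaken (∷⁺ʳ _ there) there E)) | t n
  ... | D′ | here refl = cut-principal c (condR D′) ⊆-refl ⊆-refl E
  ... | D′ | there n′  = condR n′ D′
  cut-step c s t (ident h m D) E =
    ident h (s m) (cut-step c (∷⁺ʳ _ s) t D (weaken (∷⁺ʳ _ there) ⊆-refl E))
  cut-step c s t (mp h n D) E
    with cut-step c s (⊆-under t) D (weakenR E) | t n
  ... | D′ | here refl = cut-principal c (mp h D′) ⊆-refl ⊆-refl E
  ... | D′ | there n′  = mp h n′ D′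

  mutual

    -- A transition formula calls labelled cuts on the same `A`, but is itself reached only from a
    -- conditional with antecedent `A`; every cycle of calls therefore descends to a proper
    -- subformula.
    cut-labelled : ∀ A x → Cut (x ∶ A)
    cut-labelled (var p) x = cut-step tt ⊆-refl ⊆-refl
    cut-labelled ⊥′      x = cut-step tt ⊆-refl ⊆-refl
    cut-labelled (A ⟶ B) x = cut-step (cut-labelled A , cut-labelled B) ⊆-refl ⊆-refl
    cut-labelled (A ⇒ B) x = cut-step (cut-transition A x , cut-labelled B) ⊆-refl ⊆-refl

    cut-transition : ∀ A x y → Cut (x ─⟨ A ⟩→ y)
    cut-transition A x y = cut-step (cut-labelled A) ⊆-refl ⊆-refl

  cut : ∀ F → Cut F
  cut (x ∶ A)       = cut-labelled A x
  cut (x ─⟨ A ⟩→ y) = cut-transition A x y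

-- Relabelling and the translation from `⊢` to `⊩`

module _ {Atom 𝒜 : Set} where

  rename : (𝒜 → 𝒜) → SeqFormula Atom 𝒜 → SeqFormula Atom 𝒜
  rename σ (x ∶ A)       = σ x ∶ A
  rename σ (x ─⟨ A ⟩→ y) = σ x ─⟨ A ⟩→ σ y

  rename-cong : ∀ {σ τ} F → (∀ {z} → z ∈ labels F → σ z ≡ τ z) → rename σ F ≡ rename τ F
  rename-cong (x ∶ A)       σ≗τ = cong (_∶ A) (σ≗τ (here refl))
  rename-cong (x ─⟨ A ⟩→ y) σ≗τ =
    cong₂ (_─⟨ A ⟩→_) (σ≗τ (here refl)) (σ≗τ (there (here refl)))

  rename-id : ∀ F → rename id F ≡ F
  rename-id (x ∶ A)       = refl
  rename-id (x ─⟨ A ⟩→ y) = refl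

module _ {𝒜 : Set} (_≟_ : DecidableEquality 𝒜) where

  update : (𝒜 → 𝒜) → 𝒜 → 𝒜 → 𝒜 → 𝒜
  update σ y z x with x ≟ y
  ... | yes _ = z
  ... | no  _ = σ x

  update-≡ : ∀ σ y z → update σ y z y ≡ z
  update-≡ σ y z with y ≟ y
  ... | yes _   = refl
  ... | no  y≢y = ⊥-elim (y≢y refl)

  update-≢ : ∀ σ {y z x} → x ≢ y → update σ y z x ≡ σ x
  update-≢ σ {y} {z} {x} x≢y with x ≟ y
  ... | yes x≡y = ⊥-elim (x≢y x≡y)
  ... | no  _   = refl

  rename-update-fresh : ∀ {Atom} σ {y z} {Γ : List (SeqFormula Atom 𝒜)} → y FreshFor Γ →
                        map (rename (update σ y z)) Γ ≡ map (rename σ) Γ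
  rename-update-fresh σ y#Γ =
    map-cong-local (All.map
      (λ {F} y∉F → rename-cong F λ z∈F → update-≢ σ λ { refl → y∉F z∈F }) y#Γ)

  -- Quantifying over all relabellings σ supplies the premises of condR and eq at
  -- every label: redirect the eigenlabel of ⇒R to z, and collapse all labels to u.
  ⊢⇒⊩ : ∀ {Atom S} {Γ Δ : List (SeqFormula Atom 𝒜)} → Γ ⊢[ S ] Δ →
        ∀ σ → map (rename σ) Γ ⊩[ S ] map (rename σ) Δ
  ⊢⇒⊩ (perm p q D)  σ = weaken (map⁺ _ (⊆-reflexive-↭ p)) (map⁺ _ (⊆-reflexive-↭ q)) (⊢⇒⊩ D σ)
  ⊢⇒⊩ AX            σ = ax (here refl) (here refl)
  ⊢⇒⊩ A⊥            σ = bot (here refl)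
  ⊢⇒⊩ (WeakL D)     σ = weakenL (⊢⇒⊩ D σ)
  ⊢⇒⊩ (WeakR D)     σ = weakenR (⊢⇒⊩ D σ)
  ⊢⇒⊩ (ContrL D)    σ = weaken ⊆-contract ⊆-refl (⊢⇒⊩ D σ)
  ⊢⇒⊩ (ContrR D)    σ = weaken ⊆-refl ⊆-contract (⊢⇒⊩ D σ)
  ⊢⇒⊩ (⟶R D)        σ = impR (here refl) (weaken ⊆-refl (∷⁺ʳ _ there) (⊢⇒⊩ D σ))
  ⊢⇒⊩ (⟶L D E)      σ =
    impL (here refl) (weakenL (⊢⇒⊩ D σ)) (weaken (∷⁺ʳ _ there) ⊆-refl (⊢⇒⊩ E σ))
  ⊢⇒⊩ (EQ D E)      σ =
    eq (here refl) (here refl) (λ u → ⊢⇒⊩ D (λ _ → u)) (λ u → ⊢⇒⊩ E (λ _ → u))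
  ⊢⇒⊩ (⇒L D E)      σ =
    condL (here refl) (weakenL (⊢⇒⊩ D σ)) (weaken (∷⁺ʳ _ there) ⊆-refl (⊢⇒⊩ E σ))
  ⊢⇒⊩ (⇒R {S} {x = x} {y} {A} {B} y#Γ y#Δ y≢x D) σ = condR (here refl) λ z →
    weaken ⊆-refl (∷⁺ʳ _ there)
      (subst₂ (_⊩[ S ]_)
        (cong₂ _∷_ (cong₂ (_─⟨ A ⟩→_) (update-≢ σ (y≢x ∘ sym)) (update-≡ σ y z))
                   (rename-update-fresh σ y#Γ))
        (cong₂ _∷_ (cong (_∶ B) (update-≡ σ y z)) (rename-update-fresh σ y#Δ))
        (⊢⇒⊩ D (update σ y z)))
  ⊢⇒⊩ (idL h D)     σ = ident h (here refl) (weaken (∷⁺ʳ _ there) ⊆-refl (⊢⇒⊩ D σ))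
  ⊢⇒⊩ (mpR h D)     σ = mp h (here refl) (weaken ⊆-refl (∷⁺ʳ _ there) (⊢⇒⊩ D σ))

-- The translation from `⊩` to `⊢`

module _ {Atom 𝒜 : Set} {S : Calculus} where

  -- A rule of `⊢` puts a new copy of its principal formula at the head; contraction merges it with
  -- the occurrence that `⊩` found by membership.
  absorbL : ∀ {Γ Δ : List (SeqFormula Atom 𝒜)} {F} → F ∈ Γ → F ∷ Γ ⊢[ S ] Δ → Γ ⊢[ S ] Δ
  absorbL F∈Γ D with Γ′ , p ← ∈⇒↭-head F∈Γ =
    perm (↭-sym p) refl (ContrL (perm (prep _ p) refl D))

  absorbR : ∀ {Γ Δ : List (SeqFormula Atom 𝒜)} {F} → F ∈ Δ → Γ ⊢[ S ] F ∷ Δ → Γ ⊢[ S ] Δ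
  absorbR F∈Δ D with Δ′ , p ← ∈⇒↭-head F∈Δ =
    perm refl (↭-sym p) (ContrR (perm refl (prep _ p) D))

module _ {𝒜 : Set} (den : Denumerable 𝒜) where

  open Inverse den using (to; from; strictlyInverseˡ)

  fresh : ∀ (xs : List 𝒜) → ∃[ y ] y ∉ xs
  -- `n` exceeds the number of every label in `xs`, while `from n` has number `n`.
  fresh xs = from n , λ y∈xs →
    1+n≰n (subst (_≤ max 0 (map to xs)) (strictlyInverseˡ n)
      (All.lookup (xs≤max 0 (map to xs)) (∈-map⁺ to y∈xs)))
    where
    n : ℕ
    n = suc (max 0 (map to xs))

  freshFor : ∀ {Atom} (Γ : List (SeqFormula Atom 𝒜)) → ∃[ y ] y FreshFor Γ
  freshFor Γ with y , y∉ ← fresh (concatMap labels Γ) =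
    y , All.map (λ all y∈ → All.lookup all y∈ refl) (map⁻ (concat⁻ (¬Any⇒All¬ _ y∉)))

  ⊩⇒⊢ : ∀ {Atom S} {Γ Δ : List (SeqFormula Atom 𝒜)} → Γ ⊩[ S ] Δ → Γ ⊢[ S ] Δ
  ⊩⇒⊢ (ax m n)      = absorbL m (absorbR n AX)
  ⊩⇒⊢ (bot m)       = absorbL m A⊥
  ⊩⇒⊢ (impR n D)    = absorbR n (⟶R (⊩⇒⊢ D))
  ⊩⇒⊢ (impL m D E)  = absorbL m (⟶L (⊩⇒⊢ D) (⊩⇒⊢ E))
  -- `EQ` asks for a single label; the source `x` is at hand.
  ⊩⇒⊢ (eq {x} m n D E) = absorbL m (absorbR n (EQ (⊩⇒⊢ (D x)) (⊩⇒⊢ (E x))))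
  ⊩⇒⊢ (condL m D E) = absorbL m (⇒L (⊩⇒⊢ D) (⊩⇒⊢ E))
  ⊩⇒⊢ {Γ = Γ} {Δ} (condR n D) with y , y# ← freshFor (Γ ++ Δ) =
    -- The condition `y ≢ x` follows from freshness for `Δ`, since `x` labels the principal formula
    -- there.
    absorbR n (⇒R (++⁻ˡ Γ y#) (++⁻ʳ Γ y#) (All.lookup (++⁻ʳ Γ y#) n ∘ here) (⊩⇒⊢ (D y)))
  ⊩⇒⊢ (ident h m D) = absorbL m (idL h (⊩⇒⊢ D))
  ⊩⇒⊢ (mp h n D)    = absorbR n (mpR h (⊩⇒⊢ D))

theorem3p7 : (Atom 𝒜 : Set) → Denumerable 𝒜 → (S : Calculus) →
    (Γ Δ : List (SeqFormula Atom 𝒜)) (F : SeqFormula Atom 𝒜) →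
    Γ ⊢[ S ] F ∷ Δ → F ∷ Γ ⊢[ S ] Δ → Γ ⊢[ S ] Δ
theorem3p7 Atom 𝒜 den S Γ Δ F D E = ⊩⇒⊢ den (cut F (embed D) (embed E))
  where
  embed : {Γ Δ : List (SeqFormula Atom 𝒜)} → Γ ⊢[ S ] Δ → Γ ⊩[ S ] Δ
  -- The identity relabelling is used; equality of labels is decided through their numbers.
  embed D = subst₂ (_⊩[ S ]_) map-rename-id map-rename-id (⊢⇒⊩ (eq? (↔⇒↣ den)) D id)
    where
    map-rename-id : {Γ : List (SeqFormula Atom 𝒜)} → map (rename id) Γ ≡ Γ
    map-rename-id = map-id-local (All.universal rename-id _)
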